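{- The generating function $$G_{(231,312)}(x,p,q,y,z)=\sum_{n\ge 0}\ \sum_{\pi\in S_n(231,312)} x^n p^{\operatorname{asc}(\pi)} q^{\operatorname{des}(\pi)} y^{\operatorname{MNA}(\pi)} z^{\operatorname{MND}(\pi)}$$ is equal to $$\frac{1 + x + p x^2 y - p^2 x^2 y + q x^2 z - q^2 x^2 z - p q x^2 y z + p q x^3 y z - p^2 q x^3 y z - p q^2 x^3 y z}{1 - p^2 x^2 y - q^2 x^2 z - p q x^2 y z - p^2 q x^3 y z - p q^2 x^3 y z}.$$
   Context: For $n\ge 0$, $S_n$ denotes the set of permutations $\pi=\pi_1\pi_2\cdots\pi_n$ of $[n]=\{1,\dots,n\}$ ($S_0$ consists of the empty permutation, for which all statistics below are $0$). A permutation $\pi\in S_n$ avoids a pattern $\tau\in S_k$ if there are no indices $i_1<\dots<i_k$ such that $\pi_{i_a}<\pi_{i_b}$ if and only if $\tau_a<\tau_b$; $S_n(\tau,\rho)$ is the set of permutations in $S_n$ avoiding both $\tau$ and $\rho$. $\operatorname{asc}(\pi)$ (resp. $\operatorname{des}(\pi)$) is the number of $i\in[n-1]$ with $\pi_i<\pi_{i+1}$ (resp. $\pi_i>\pi_{i+1}$). $\operatorname{MNA}(\pi)$ is the maximum size of a set $I\subseteq[n-1]$ such that $\pi_i<\pi_{i+1}$ for all $i\in I$ and $|i-j|\ge 2$ for distinct $i,j\in I$; $\operatorname{MND}(\pi)$ is defined analogously with $\pi_i>\pi_{i+1}$. -}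

module Defs where

open import Algebra.Bundles.Raw using (RawRing)
import Algebra.Definitions.RawMonoid as RawMonoidDefs
import Algebra.Definitions.RawSemiring as RawSemiringDefs
open import Data.Fin.Base as Fin using (Fin; zero; suc; toℕ; inject₁)
open import Data.Fin.Patterns using (0F; 1F; 2F; 3F; 4F)
import Data.Fin.Properties as Fin
open import Data.Fin.Subset using (Subset; inside; outside; _∈_; _⊆_; ∣_∣)
open import Data.Fin.Subset.Properties using (_∈?_; _⊆?_)
import Data.Integer.Base as ℤ
open import Data.List.Base as List using (List; []; _∷_; allFin; cartesianProductWith; filter; foldr)
open import Data.List.Extrema.Nat using (max)
open import Data.Nat.Base as ℕ using (ℕ; zero; suc; pred; _∸_; _≤_)
import Data.Nat.Properties as ℕ
open import Data.Product.Base using (∃; _×_; _,_; uncurry)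
open import Data.Vec.Base using (Vec; []; _∷_; lookup; tabulate)
open import Data.Vec.Relation.Unary.AllPairs using (AllPairs; allPairs?)
open import Data.Vec.Relation.Unary.Unique.Propositional using (Unique)
open import Function.Base using (flip)
open import Function.Bundles using (_⇔_; mk⇔; module Equivalence)
open import Level using (Level; 0ℓ)
open import Relation.Binary.Core using (Rel)
import Relation.Binary.Definitions as Binary
open import Relation.Binary.PropositionalEquality.Core using (_≢_)
open import Relation.Nullary.Decidable using (Dec; does; map′; ¬?; _×-dec_; _→-dec_)
open import Relation.Nullary.Negation using (¬_)
open import Relation.Unary using (Pred; Decidable)

private
  variable
    a c ℓ : Level
    A : Set a
    k n : ℕ

------------------------------------------------------------------------
-- Words and permutations

words : List A → ∀ k → List (Vec A k)
words as zero    = [] ∷ []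
words as (suc k) = cartesianProductWith _∷_ as (words as k)

anyWord? : {P : Pred (Vec (Fin n) k) ℓ} → Decidable P → Dec (∃ P)
anyWord? {k = zero}  P? = map′ (λ p → [] , p) (λ { ([] , p) → p }) (P? [])
anyWord? {k = suc k} P? =
  map′ (λ { (i , w , p) → i ∷ w , p }) (λ { (i ∷ w , p) → i , w , p })
       (Fin.any? λ i → anyWord? λ w → P? (i ∷ w))

-- A permutation π of [n] is given in one-line notation, as a word
-- π₁⋯πₙ of n distinct letters. Positions and letters are numbered from
-- 0, so the letter v of [n] is v - 1 here.

unique? : Decidable (Unique {A = Fin n} {n = k})
unique? = allPairs? λ i j → ¬? (i Fin.≟ j)

permutations : ∀ n → List (Vec (Fin n) n)
permutations n = filter unique? (words (allFin n) n)

------------------------------------------------------------------------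
-- Pattern avoidance

Occurrence : Vec (Fin k) k → Vec (Fin n) n → Vec (Fin n) k → Set
Occurrence τ π i =
  AllPairs Fin._<_ i ×
  (∀ a b → (lookup π (lookup i a) Fin.< lookup π (lookup i b)) ⇔
           (lookup τ a Fin.< lookup τ b))

Avoids : Vec (Fin k) k → Vec (Fin n) n → Set
Avoids τ π = ¬ ∃ (Occurrence τ π)

_⇔-dec_ : {A B : Set} → Dec A → Dec B → Dec (A ⇔ B)
a? ⇔-dec b? =
  map′ (uncurry mk⇔) (λ e → Equivalence.to e , Equivalence.from e)
       ((a? →-dec b?) ×-dec (b? →-dec a?))

occurrence? : (τ : Vec (Fin k) k) (π : Vec (Fin n) n) →
              Decidable (Occurrence τ π)
occurrence? τ π i =
  allPairs? Fin._<?_ i ×-dec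
  (Fin.all? λ a → Fin.all? λ b →
    (lookup π (lookup i a) Fin.<? lookup π (lookup i b)) ⇔-dec
    (lookup τ a Fin.<? lookup τ b))

avoids? : (τ : Vec (Fin k) k) → Decidable (Avoids {n = n} τ)
avoids? τ π = ¬? (anyWord? (occurrence? τ π))

avoiders : Vec (Fin k) k → Vec (Fin k) k → ∀ n → List (Vec (Fin n) n)
avoiders τ ρ n =
  filter (λ π → avoids? τ π ×-dec avoids? ρ π) (permutations n)

pattern231 pattern312 : Vec (Fin 3) 3
pattern231 = 1F ∷ 2F ∷ 0F ∷ []
pattern312 = 2F ∷ 0F ∷ 1F ∷ []

------------------------------------------------------------------------
-- Permutation statistics

-- The set of i ∈ [n-1] such that πᵢ and πᵢ₊₁ are related.
consecutive : {R : Rel (Fin n) 0ℓ} → Binary.Decidable R →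
              Vec (Fin n) n → Subset (pred n)
consecutive {n = zero}  R? π = []
consecutive {n = suc n} R? π =
  tabulate λ i → does (R? (lookup π (inject₁ i)) (lookup π (suc i)))

ascents descents : Vec (Fin n) n → Subset (pred n)
ascents  = consecutive Fin._<?_
descents = consecutive (flip Fin._<?_)

NonAdjacent : Subset k → Set
NonAdjacent I =
  ∀ i j → i ∈ I → j ∈ I → i ≢ j → 2 ≤ ℕ.∣ toℕ i - toℕ j ∣

nonAdjacent? : Decidable (NonAdjacent {k})
nonAdjacent? I =
  Fin.all? λ i → Fin.all? λ j →
    (i ∈? I) →-dec ((j ∈? I) →-dec
      (¬? (i Fin.≟ j) →-dec (2 ℕ.≤? ℕ.∣ toℕ i - toℕ j ∣)))

subsets : ∀ k → List (Subset k)
subsets = words (inside ∷ outside ∷ [])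

-- The default value 0 is the size of the empty subset, which always
-- qualifies.
maxNonAdjacent : Subset k → ℕ
maxNonAdjacent {k} S =
  max 0 (List.map ∣_∣
    (filter (λ I → (I ⊆? S) ×-dec nonAdjacent? I) (subsets k)))

asc des MNA MND : Vec (Fin n) n → ℕ
asc π = ∣ ascents π ∣
des π = ∣ descents π ∣
MNA π = maxNonAdjacent (ascents π)
MND π = maxNonAdjacent (descents π)

------------------------------------------------------------------------
-- Formal power series

-- R⟦X⟧, a series being the sequence of its coefficients.
module PowerSeries (R : RawRing c ℓ) where
  open RawRing R
  open RawMonoidDefs +-rawMonoid using (sum)

  constant : Carrier → ℕ → Carrier
  constant r zero    = r
  constant r (suc n) = 0#

  X : ℕ → Carrier
  X 1 = 1#
  X _ = 0#

  rawRing : RawRing c ℓ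
  rawRing = record
    { Carrier = ℕ → Carrier
    ; _≈_     = λ f g → ∀ n → f n ≈ g n
    ; _+_     = λ f g n → f n + g n
    ; _*_     = λ f g n → sum λ (i : Fin (suc n)) → f (toℕ i) * g (n ∸ toℕ i)
    ; -_      = λ f n → - f n
    ; 0#      = constant 0#
    ; 1#      = constant 1#
    }

-- Formal power series over ℤ in k commuting variables, as an iterated
-- ring of univariate series: var zero is the outermost variable.
ℤ⟦_⟧ : ℕ → RawRing 0ℓ 0ℓ
ℤ⟦ zero  ⟧ = ℤ.+-*-rawRing
ℤ⟦ suc k ⟧ = PowerSeries.rawRing ℤ⟦ k ⟧

var : ∀ k → Fin k → RawRing.Carrier ℤ⟦ k ⟧
var (suc k) zero    = PowerSeries.X ℤ⟦ k ⟧
var (suc k) (suc i) = PowerSeries.constant ℤ⟦ k ⟧ (var k i)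

------------------------------------------------------------------------
-- The generating function

module _ where
  open RawRing ℤ⟦ 4 ⟧
  open RawSemiringDefs rawSemiring using (_^_)

  weight : Vec (Fin n) n → Carrier
  weight π = p ^ asc π * q ^ des π * y ^ MNA π * z ^ MND π
    where
    p = var 4 0F
    q = var 4 1F
    y = var 4 2F
    z = var 4 3F

  -- The coefficient of xⁿ in G: as ℤ⟦ 5 ⟧ is ℤ⟦ 4 ⟧⟦x⟧, the factor xⁿ
  -- is accounted for by the index.
  coefficient : Vec (Fin k) k → Vec (Fin k) k → ℕ → Carrier
  coefficient τ ρ n = foldr _+_ 0# (List.map weight (avoiders τ ρ n))

open RawRing ℤ⟦ 5 ⟧ public
  using (Carrier; _≈_; _+_; _*_; -_; 0#; 1#; rawSemiring)
open RawSemiringDefs rawSemiring public using (_^_)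

infixl 6 _-_
_-_ : Carrier → Carrier → Carrier
f - g = f + (- g)

x p q y z : Carrier
x = var 5 0F
p = var 5 1F
q = var 5 2F
y = var 5 3F
z = var 5 4F

G : Vec (Fin k) k → Vec (Fin k) k → Carrier
G τ ρ = coefficient τ ρ

{-# OPTIONS --safe #-}

-- The permutations avoiding 231 and 312 are the layered ones (increasing
-- sequences of decreasing runs of consecutive values), so that each
-- subset of [n-1] is the ascent set of exactly one of them, and the
-- descent set is its complement. The coefficient of xⁿ⁺¹ is thus a sum
-- over all subsets S of [n]. A maximum non-adjacent subset of S is found
-- greedily from the left; whether the preceding position was taken is
-- the state of a transfer matrix with three states, and eliminating two
-- unknowns from the linear system for the three corresponding series
-- gives the rational function.

module Submission where

open import Algebra.Bundles using (CommutativeRing; Semiring)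
open import Algebra.Bundles.Raw using (RawRing)
open import Algebra.Core using (Op₁; Op₂)
import Algebra.Definitions.RawSemiring as RawSemiringDefs
import Algebra.Properties.CommutativeSemigroup as CommutativeSemigroupProperties
import Algebra.Properties.Group as GroupProperties
import Algebra.Properties.Semiring.Sum as Sum
import Algebra.Solver.Ring.NaturalCoefficients.Default as SemiringSolver
open import Algebra.Structures using (IsCommutativeRing)
open import Data.Bool.Base using (Bool; true; false; not)
open import Data.Empty using (⊥-elim)
open import Data.Fin.Base as Fin using (Fin; zero; suc; toℕ; inject₁; punchIn; punchOut)
open import Data.Fin.Patterns using (0F; 1F; 2F; 3F)
import Data.Fin.Properties as Fin
open import Data.Fin.Subset using (Subset; inside; outside; _⊆_; ∣_∣; ∁)
open import Data.Fin.Subset.Properties using (drop-∷-⊆; _⊆?_)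
import Data.Integer.Properties as ℤ
open import Data.List.Base as List using (List; []; _∷_; _++_; allFin; foldr)
open import Data.List.Extrema.Nat using (max≤v⁺; v≤max⁺)
open import Data.List.Membership.Propositional using () renaming (_∈_ to _∈ₗ_)
open import Data.List.Membership.Propositional.Properties
  using (∈-cartesianProductWith⁺; ∈-filter⁺; ∈-filter⁻; ∈-map⁺; ∈-map⁻; ∈-allFin)
import Data.List.Membership.Propositional.Properties.WithK as Membership
import Data.List.Properties as List
open import Data.List.Relation.Binary.BagAndSetEquality using (∼bag⇒↭)
open import Data.List.Relation.Binary.Permutation.Propositional using (_↭_; ↭⇒↭ₛ′)
import Data.List.Relation.Binary.Permutation.Propositional.Properties as Permutation
import Data.List.Relation.Binary.Permutation.Setoid.Properties as PermutationSetoid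
import Data.List.Relation.Unary.All as All
import Data.List.Relation.Unary.AllPairs as ListAllPairs
open import Data.List.Relation.Unary.Any as Any using (here; there)
open import Data.List.Relation.Unary.Unique.Propositional using () renaming (Unique to Uniqueₗ)
import Data.List.Relation.Unary.Unique.Propositional.Properties as Uniqueₗ
open import Data.Nat.Base as ℕ using (ℕ; zero; suc; z≤n; s≤s; z<s; s<s)
import Data.Nat.Properties as ℕ
open import Data.Product.Base using (_,_; _×_; proj₁; proj₂; ∃; ∃-syntax)
open import Data.Sum.Base using (inj₂)
open import Data.Vec.Base as Vec using (Vec; []; _∷_; here; there; lookup; tabulate)
import Data.Vec.Properties as Vec
open import Data.Vec.Relation.Unary.All using ([]; _∷_)
open import Data.Vec.Relation.Unary.AllPairs using ([]; _∷_)
open import Data.Vec.Relation.Unary.Unique.Propositional using (Unique)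
import Data.Vec.Relation.Unary.Unique.Propositional.Properties as Unique
open import Defs
  using ( words; subsets; NonAdjacent; nonAdjacent?; maxNonAdjacent
        ; unique?; permutations; Occurrence; Avoids; avoids?; avoiders
        ; pattern231; pattern312; ascents; descents; asc; des; MNA; MND
        ; module PowerSeries; ℤ⟦_⟧; var; weight)
open import Function.Base using (_∘_; id)
open import Function.Bundles using (_⇔_; mk⇔; module Equivalence)
open import Level using (Level; _⊔_)
open import Relation.Binary.Core using (Rel)
open import Relation.Binary.Definitions using (tri<; tri≈; tri>)
open import Relation.Binary.PropositionalEquality as ≡ using (_≡_; _≢_; _≗_)
import Relation.Binary.Reasoning.Setoid as ≈-Reasoning
open import Relation.Nullary.Decidable using (Dec; yes; no; does; does-⇔; dec-false; _×-dec_)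
open import Relation.Nullary.Negation using (¬_; contradiction)

-- Existence and uniqueness of the permutation with a given ascent set have different sources: one
-- is built by inserting entries from the right, while two of them have the same relative order and
-- hence agree, both being bijections onto the same finite chain. Three states suffice for both
-- statistics because every position is an ascent or a descent: a choice blocks the next position
-- for one of the two kinds only, and the step after it always lifts the block. Division is not an
-- operation on series, so the quotient is the numerator times a series shown to be inverse to the
-- denominator; since the latter is 1 - α x² - β x³, such an inverse is given by a recurrence on
-- coefficients. The polynomial identities are left to a semiring solver, hence negative terms are
-- moved to the other side or treated as atoms.

private
  variable
    a : Level
    A : Set a
    k m n : ℕ

-- Maximum non-adjacent subsets

∈-words : {as : List A} → (∀ a → a ∈ₗ as) → (w : Vec A k) → w ∈ₗ words as k
∈-words ∈as []      = here ≡.refl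
∈-words ∈as (a ∷ w) = ∈-cartesianProductWith⁺ _∷_ (∈as a) (∈-words ∈as w)

∈-subsets : (S : Subset k) → S ∈ₗ subsets k
∈-subsets = ∈-words λ { true → here ≡.refl ; false → there (here ≡.refl) }

greedy skip : Subset k → ℕ
greedy []            = 0
greedy (outside ∷ S) = greedy S
greedy (inside  ∷ S) = suc (skip S)
skip []      = 0
skip (_ ∷ S) = greedy S

-- The exchange argument behind greedy choice: blocking the first position costs 0 or 1. The two
-- bounds are proved together because an `inside` position reduces each of them to the other on the
-- tail.
greedy≤1+skip : (S : Subset k) → greedy S ℕ.≤ suc (skip S)
skip≤greedy   : (S : Subset k) → skip S ℕ.≤ greedy S
greedy≤1+skip []            = z≤n
greedy≤1+skip (outside ∷ S) = ℕ.n≤1+n _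
greedy≤1+skip (inside  ∷ S) = s≤s (skip≤greedy S)
skip≤greedy []            = z≤n
skip≤greedy (outside ∷ S) = ℕ.≤-refl
skip≤greedy (inside  ∷ S) = greedy≤1+skip S

tail-nonAdjacent : ∀ {b} {I : Subset k} → NonAdjacent (b ∷ I) → NonAdjacent I
tail-nonAdjacent na i j i∈ j∈ i≢j = na (suc i) (suc j) (there i∈) (there j∈) (i≢j ∘ Fin.suc-injective)

-- If `I` takes the first position it has to leave out the second, so both sides advance by two. If
-- it passes over a position that the greedy choice takes, `greedy≤1+skip` shows that nothing is
-- gained by this.
∣nonAdjacent∣≤greedy : (I S : Subset k) → I ⊆ S → NonAdjacent I → ∣ I ∣ ℕ.≤ greedy S
∣nonAdjacent∣≤greedy []            []            _   _  = z≤n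
∣nonAdjacent∣≤greedy (outside ∷ I) (outside ∷ S) I⊆S na =
  ∣nonAdjacent∣≤greedy I S (drop-∷-⊆ I⊆S) (tail-nonAdjacent na)
∣nonAdjacent∣≤greedy (outside ∷ I) (inside ∷ S)  I⊆S na =
  ℕ.≤-trans (∣nonAdjacent∣≤greedy I S (drop-∷-⊆ I⊆S) (tail-nonAdjacent na)) (greedy≤1+skip S)
∣nonAdjacent∣≤greedy (inside ∷ I)  (outside ∷ S) I⊆S na = contradiction (I⊆S here) λ ()
∣nonAdjacent∣≤greedy (inside ∷ []) (inside ∷ []) I⊆S na = ℕ.≤-refl
∣nonAdjacent∣≤greedy (inside ∷ inside ∷ I)  (inside ∷ _ ∷ S) I⊆S na =
  contradiction (na zero (suc zero) here (there here) (λ ())) λ { (s≤s ()) }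
∣nonAdjacent∣≤greedy (inside ∷ outside ∷ I) (inside ∷ _ ∷ S) I⊆S na =
  s≤s (∣nonAdjacent∣≤greedy I S (drop-∷-⊆ (drop-∷-⊆ I⊆S)) (tail-nonAdjacent (tail-nonAdjacent na)))

outside∷-nonAdjacent : {I : Subset k} → NonAdjacent I → NonAdjacent (outside ∷ I)
outside∷-nonAdjacent na (suc i) (suc j) (there i∈) (there j∈) i≢j = na i j i∈ j∈ (i≢j ∘ ≡.cong suc)

inside∷outside∷-nonAdjacent : {I : Subset k} → NonAdjacent I → NonAdjacent (inside ∷ outside ∷ I)
inside∷outside∷-nonAdjacent na zero          zero          _  _  0≢0 = contradiction ≡.refl 0≢0
inside∷outside∷-nonAdjacent na zero          (suc (suc j)) _  _  _   = s≤s (s≤s z≤n)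
inside∷outside∷-nonAdjacent na (suc (suc i)) zero          _  _  _   = s≤s (s≤s z≤n)
inside∷outside∷-nonAdjacent na (suc i)       (suc j)       (there i∈) (there j∈) i≢j =
  outside∷-nonAdjacent na i j i∈ j∈ (i≢j ∘ ≡.cong suc)
inside∷outside∷-nonAdjacent na zero          (suc zero)    _  (there ()) _
inside∷outside∷-nonAdjacent na (suc zero)    zero          (there ()) _ _

∷-⊆ : ∀ {b} {I S : Subset k} → I ⊆ S → b ∷ I ⊆ b ∷ S
∷-⊆ I⊆S here       = here
∷-⊆ I⊆S (there i∈) = there (I⊆S i∈)

outside∷-⊆ : ∀ {b} {I S : Subset k} → I ⊆ S → outside ∷ I ⊆ b ∷ S
outside∷-⊆ I⊆S (there i∈) = there (I⊆S i∈)

greedy-attained : (S : Subset k) → ∃ λ I → I ⊆ S × NonAdjacent I × ∣ I ∣ ≡ greedy S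
greedy-attained []            = [] , (λ x → x) , (λ ()) , ≡.refl
greedy-attained (outside ∷ S) with I , I⊆S , na , eq ← greedy-attained S =
  outside ∷ I , outside∷-⊆ I⊆S , outside∷-nonAdjacent na , eq
greedy-attained (inside ∷ []) = inside ∷ [] , (λ x → x) , na , ≡.refl
  where
  na : NonAdjacent (inside ∷ [])
  na zero zero _ _ 0≢0 = contradiction ≡.refl 0≢0
greedy-attained (inside ∷ _ ∷ S) with I , I⊆S , na , eq ← greedy-attained S =
  inside ∷ outside ∷ I , ∷-⊆ (outside∷-⊆ I⊆S) , inside∷outside∷-nonAdjacent na , ≡.cong suc eq

maxNonAdjacent≡greedy : (S : Subset k) → maxNonAdjacent S ≡ greedy S
maxNonAdjacent≡greedy {k} S = ℕ.≤-antisym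
  (max≤v⁺ z≤n (All.tabulate bound))
  (v≤max⁺ 0 sizes (inj₂ (Any.map ℕ.≤-reflexive greedy∈)))
  where
  candidate? = λ I → (I ⊆? S) ×-dec nonAdjacent? I
  sizes = List.map ∣_∣ (List.filter candidate? (subsets k))
  bound : ∀ {m} → m ∈ₗ sizes → m ℕ.≤ greedy S
  bound m∈ with I , I∈ , ≡.refl ← ∈-map⁻ ∣_∣ m∈
           with _ , I⊆S , na ← ∈-filter⁻ candidate? {xs = subsets k} I∈ =
    ∣nonAdjacent∣≤greedy I S I⊆S na
  greedy∈ : greedy S ∈ₗ sizes
  greedy∈ with I , I⊆S , na , eq ← greedy-attained S =
    ≡.subst (_∈ₗ sizes) eq (∈-map⁺ ∣_∣ (∈-filter⁺ candidate? (∈-subsets I) ((λ {x} → I⊆S {x}) , na)))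

-- Layered permutations

does-≡⇒→ : {P Q : Set} (P? : Dec P) (Q? : Dec Q) → does P? ≡ does Q? → P → Q
does-≡⇒→ _        (yes q) _ _ = q
does-≡⇒→ (no ¬p)  (no _)  _ p = contradiction p ¬p

does-complement : {P Q : Set} (P? : Dec P) (Q? : Dec Q) → (P → ¬ Q) → (¬ P → Q) →
                  does Q? ≡ not (does P?)
does-complement (yes p) (yes q) ¬both _   = contradiction q (¬both p)
does-complement (yes _) (no _)  _     _   = ≡.refl
does-complement (no _)  (yes _) _     _   = ≡.refl
does-complement (no ¬p) (no ¬q) _     one = contradiction (one ¬p) ¬q

punchIn-mono-< : ∀ i {j k : Fin n} → j Fin.< k → punchIn i j Fin.< punchIn i k
punchIn-mono-< i j<k = ℕ.≰⇒> (ℕ.<⇒≱ j<k ∘ Fin.punchIn-cancel-≤ i _ _)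

punchIn-cancel-< : ∀ i {j k : Fin n} → punchIn i j Fin.< punchIn i k → j Fin.< k
punchIn-cancel-< i ↑j<↑k = ℕ.≰⇒> (ℕ.<⇒≱ ↑j<↑k ∘ Fin.punchIn-mono-≤ i _ _)

punchIn-below : ∀ (i : Fin (suc n)) j → toℕ j ℕ.< toℕ i → punchIn i j Fin.< i
punchIn-below (suc i) zero    _         = z<s
punchIn-below (suc i) (suc j) (s<s j<i) = s<s (punchIn-below i j j<i)

punchIn-below⁻¹ : ∀ (i : Fin (suc n)) j → punchIn i j Fin.< i → toℕ j ℕ.< toℕ i
punchIn-below⁻¹ (suc i) zero    _         = z<s
punchIn-below⁻¹ (suc i) (suc j) (s<s ↑j<i) = s<s (punchIn-below⁻¹ i j ↑j<i)

punchIn-above⁻¹ : ∀ (i : Fin (suc n)) j → i Fin.< punchIn i j → toℕ i ℕ.≤ toℕ j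
punchIn-above⁻¹ zero    j       _          = z≤n
punchIn-above⁻¹ (suc i) (suc j) (s<s i<↑j) = s≤s (punchIn-above⁻¹ i j i<↑j)

-- The codomain is independent of the length, so that tails qualify as well although they are no
-- longer permutations.
record Layered (f : Fin k → Fin m) : Set where
  field
    injective : ∀ {i j} → f i ≡ f j → i ≡ j
    no231     : ∀ {i j l} → i Fin.< j → j Fin.< l → f l Fin.< f i → ¬ (f i Fin.< f j)
    no312     : ∀ {i j l} → i Fin.< j → j Fin.< l → f j Fin.< f l → ¬ (f l Fin.< f i)

  ≮⇒> : ∀ {i j} → i ≢ j → ¬ (f i Fin.< f j) → f j Fin.< f i
  ≮⇒> i≢j fi≮fj = Fin.≤∧≢⇒< (ℕ.≮⇒≥ fi≮fj) (i≢j ∘ ≡.sym ∘ injective)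

open Layered

Layered-resp-≗ : {f g : Fin k → Fin m} → f ≗ g → Layered f → Layered g
Layered-resp-≗ {f = f} {g} f≗g L = record
  { injective = λ {i} {j} gi≡gj → injective L (≡.trans (f≗g i) (≡.trans gi≡gj (≡.sym (f≗g j))))
  ; no231     = λ i<j j<l gl<gi gi<gj → no231 L i<j j<l (back gl<gi) (back gi<gj)
  ; no312     = λ i<j j<l gj<gl gl<gi → no312 L i<j j<l (back gj<gl) (back gl<gi)
  }
  where
  back : ∀ {i j} → g i Fin.< g j → f i Fin.< f j
  back {i} {j} = ≡.subst₂ Fin._<_ (≡.sym (f≗g i)) (≡.sym (f≗g j))

Layered-tail : {f : Fin (suc k) → Fin m} → Layered f → Layered (f ∘ suc)
Layered-tail L = record
  { injective = Fin.suc-injective ∘ injective L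
  ; no231     = λ i<j j<l → no231 L (s<s i<j) (s<s j<l)
  ; no312     = λ i<j j<l → no312 L (s<s i<j) (s<s j<l)
  }

module _ {f : Fin (suc (suc k)) → Fin m} (L : Layered f) where

  -- A later entry below `f 0F` would complete a 231.
  ascent⇒minimum : f 0F Fin.< f 1F → ∀ i → f 0F Fin.< f (suc i)
  ascent⇒minimum f0<f1 zero    = f0<f1
  ascent⇒minimum f0<f1 (suc i) = ≮⇒> L (λ ()) λ fi<f0 → no231 L z<s (s<s z<s) fi<f0 f0<f1

  -- A later entry between the two would complete a 312. With transitivity for the converse, all
  -- entries after the descent lie on the same side of `f 0F` as of `f 1F`.
  descent⇒neighbours : f 1F Fin.< f 0F → ∀ i → f 1F Fin.< f (suc i) → f 0F Fin.< f (suc i)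
  descent⇒neighbours f1<f0 zero    f1<f1 = contradiction f1<f1 (ℕ.<-irrefl ≡.refl)
  descent⇒neighbours f1<f0 (suc i) f1<fi = ≮⇒> L (λ ()) λ fi<f0 → no312 L z<s (s<s z<s) f1<fi fi<f0

-- The order of the entries is determined by the ascents: by induction,
-- an entry followed by an ascent is below all later ones, and one
-- followed by a descent compares with later ones like its successor.
sameAscents⇒sameOrder :
  ∀ {k m n} {f : Fin (suc k) → Fin m} {g : Fin (suc k) → Fin n} → Layered f → Layered g →
  (∀ i → f (inject₁ i) Fin.< f (suc i) ⇔ g (inject₁ i) Fin.< g (suc i)) →
  ∀ i j → f i Fin.< f j → g i Fin.< g j
sameAscents⇒sameOrder Lf Lg asc zero zero f0<f0 = contradiction f0<f0 (ℕ.<-irrefl ≡.refl)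
sameAscents⇒sameOrder {suc k} Lf Lg asc (suc i) (suc j) fi<fj =
  sameAscents⇒sameOrder (Layered-tail Lf) (Layered-tail Lg) (asc ∘ suc) i j fi<fj
sameAscents⇒sameOrder {suc k} {f = f} {g} Lf Lg asc zero (suc j) f0<fj
  with f 0F Fin.<? f 1F
... | yes f0<f1 = ascent⇒minimum Lg (Equivalence.to (asc 0F) f0<f1) j
... | no  f0≮f1 = descent⇒neighbours Lg g1<g0 j
      (sameAscents⇒sameOrder (Layered-tail Lf) (Layered-tail Lg) (asc ∘ suc) 0F j
        (Fin.<-trans (≮⇒> Lf (λ ()) f0≮f1) f0<fj))
  where g1<g0 = ≮⇒> Lg (λ ()) (f0≮f1 ∘ Equivalence.from (asc 0F))
sameAscents⇒sameOrder {suc k} {f = f} {g} Lf Lg asc (suc i) zero fi<f0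
  with f 0F Fin.<? f 1F | i
... | yes f0<f1 | i     = contradiction fi<f0 (Fin.<-asym (ascent⇒minimum Lf f0<f1 i))
... | no  f0≮f1 | zero  = ≮⇒> Lg (λ ()) (f0≮f1 ∘ Equivalence.from (asc 0F))
... | no  f0≮f1 | suc i =
  Fin.<-trans
    (sameAscents⇒sameOrder (Layered-tail Lf) (Layered-tail Lg) (asc ∘ suc) (suc i) 0F
      (≮⇒> Lf (λ ()) λ f1<fi → Fin.<-asym fi<f0
        (descent⇒neighbours Lf (≮⇒> Lf (λ ()) f0≮f1) (suc i) f1<fi)))
    (≮⇒> Lg (λ ()) (f0≮f1 ∘ Equivalence.from (asc 0F)))

-- Recovering a permutation from its relative order

injective⇒surjective : {f : Fin n → Fin n} → (∀ {i j} → f i ≡ f j → i ≡ j) → ∀ v → ∃ λ i → f i ≡ v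
injective⇒surjective {suc n} {f} inj v with Fin.any? (λ i → f i Fin.≟ v)
... | yes fi≡v = fi≡v
... | no  f≢v  = ⊥-elim (Fin.<⇒notInjective ℕ.≤-refl avoid-injective)
  where
  v≢f : ∀ i → v ≢ f i
  v≢f i v≡fi = f≢v (i , ≡.sym v≡fi)
  avoid-injective : ∀ {i j} → punchOut (v≢f i) ≡ punchOut (v≢f j) → i ≡ j
  avoid-injective = inj ∘ Fin.punchOut-injective (v≢f _) (v≢f _)

increasing⇒inflationary : (f : Fin m → Fin n) → (∀ i j → i Fin.< j → f i Fin.< f j) →
                          ∀ i → toℕ i ℕ.≤ toℕ (f i)
increasing⇒inflationary f inc zero    = z≤n
increasing⇒inflationary f inc (suc i) =
  ℕ.≤-<-trans (increasing⇒inflationary (f ∘ inject₁) inc′ i)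
    (inc (inject₁ i) (suc i) (ℕ.≤-reflexive (≡.cong suc (Fin.toℕ-inject₁ i))))
  where
  inc′ : ∀ i j → i Fin.< j → f (inject₁ i) Fin.< f (inject₁ j)
  inc′ i j i<j = inc (inject₁ i) (inject₁ j)
    (≡.subst₂ ℕ._<_ (≡.sym (Fin.toℕ-inject₁ i)) (≡.sym (Fin.toℕ-inject₁ j)) i<j)

-- The map `g ∘ f⁻¹` is strictly increasing, so it never falls below the identity; the bound is this
-- fact at `f i`. Equality will follow by exchanging `f` and `g`.
sameOrder⇒≤ : {f g : Fin n → Fin n} → (∀ {i j} → f i ≡ f j → i ≡ j) →
              (∀ i j → f i Fin.< f j → g i Fin.< g j) → ∀ i → f i Fin.≤ g i
sameOrder⇒≤ {f = f} {g} inj mono i =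
  ≡.subst (λ j → f i Fin.≤ g j) (inj (f∘f⁻¹ (f i))) (increasing⇒inflationary (g ∘ f⁻¹) inc (f i))
  where
  f⁻¹ = proj₁ ∘ injective⇒surjective inj
  f∘f⁻¹ = proj₂ ∘ injective⇒surjective inj
  inc : ∀ u v → u Fin.< v → g (f⁻¹ u) Fin.< g (f⁻¹ v)
  inc u v u<v = mono (f⁻¹ u) (f⁻¹ v) (≡.subst₂ Fin._<_ (≡.sym (f∘f⁻¹ u)) (≡.sym (f∘f⁻¹ v)) u<v)

sameAscents⇒≗ : {f g : Fin (suc n) → Fin (suc n)} → Layered f → Layered g →
  (∀ i → f (inject₁ i) Fin.< f (suc i) ⇔ g (inject₁ i) Fin.< g (suc i)) → f ≗ g
sameAscents⇒≗ Lf Lg asc i = Fin.≤-antisym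
  (sameOrder⇒≤ (injective Lf) (sameAscents⇒sameOrder Lf Lg asc) i)
  (sameOrder⇒≤ (injective Lg) (sameAscents⇒sameOrder Lg Lf
    λ j → mk⇔ (Equivalence.from (asc j)) (Equivalence.to (asc j))) i)

-- The value before v in a layered permutation: v + 1 if it prolongs the
-- layer of v to the left, and 0 if it is a layer of its own.
predecessor : Bool → Fin n → Fin (suc n)
predecessor inside  v = zero
predecessor outside v = suc v

-- Each new first entry gets its value from `predecessor`, and `punchIn` makes room for it. At
-- `zero` everything later moves up; at `suc v` the values up to `v` stay, so the next entry is
-- still `v` and the new descent is by exactly one.
entry : Subset n → Fin (suc n) → Fin (suc n)
entry []      i       = i
entry (b ∷ w) zero    = predecessor b (entry w zero)
entry (b ∷ w) (suc i) = punchIn (predecessor b (entry w zero)) (entry w i)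

-- In a 231 or 312 that starts at the new first entry, some later entry lies below it, which is
-- impossible if its value is `zero`. Otherwise it compares with the entries after its neighbour
-- just as the neighbour does, and the pattern already occurs in `entry w` with the neighbour in its
-- place.
entry-layered : (w : Subset n) → Layered (entry w)
entry-layered []      = record
  { injective = id
  ; no231     = λ { {_} {zero} {zero} _ () ; {_} {zero} {suc ()} }
  ; no312     = λ { {_} {zero} {zero} _ () ; {_} {zero} {suc ()} }
  }
entry-layered {suc n} (b ∷ w) = record
  { injective = inj
  ; no231     = avoid231
  ; no312     = avoid312
  }
  where
  L = entry-layered w
  first = predecessor b (entry w zero)
  inj : ∀ {i j} → entry (b ∷ w) i ≡ entry (b ∷ w) j → i ≡ j
  inj {zero}  {zero}  _  = ≡.refl
  inj {zero}  {suc j} eq = contradiction (≡.sym eq) (Fin.punchInᵢ≢i first _)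
  inj {suc i} {zero}  eq = contradiction eq (Fin.punchInᵢ≢i first _)
  inj {suc i} {suc j} eq = ≡.cong suc (injective L (Fin.punchIn-injective first _ _ eq))

  -- `0 < l` excludes the neighbour, which lies below the new entry but not below itself. The case
  -- `inside` is empty here and in `later-above`, as nothing lies below `zero`.
  later-below : ∀ b {l : Fin (suc n)} → 0 ℕ.< toℕ l →
                punchIn (predecessor b (entry w zero)) (entry w l) Fin.< predecessor b (entry w zero) →
                entry w l Fin.< entry w zero
  later-below outside 0<l ↑l<h = Fin.≤∧≢⇒< (ℕ.≤-pred (punchIn-below⁻¹ _ _ ↑l<h))
    λ eq → ℕ.<-irrefl (≡.cong toℕ (≡.sym (injective L eq))) 0<l

  later-above : ∀ b {j l : Fin (suc n)} →
                punchIn (predecessor b (entry w zero)) (entry w l) Fin.< predecessor b (entry w zero) →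
                predecessor b (entry w zero) Fin.< punchIn (predecessor b (entry w zero)) (entry w j) →
                entry w zero Fin.< entry w j
  later-above outside _ = punchIn-above⁻¹ _ _

  ≢0⇒0< : ∀ {i : Fin (suc n)} → i ≢ 0F → 0 ℕ.< toℕ i
  ≢0⇒0< {zero}  i≢0 = contradiction ≡.refl i≢0
  ≢0⇒0< {suc i} _   = z<s

  <⇒≢0 : ∀ {i j : Fin (suc n)} → entry w i Fin.< entry w j → i ≢ j
  <⇒≢0 lt ≡.refl = ℕ.<-irrefl ≡.refl lt

  avoid231 : ∀ {i j l} → i Fin.< j → j Fin.< l → entry (b ∷ w) l Fin.< entry (b ∷ w) i →
             ¬ (entry (b ∷ w) i Fin.< entry (b ∷ w) j)
  avoid231 {suc i} {suc j} {suc l} (s<s i<j) (s<s j<l) l<i i<j′ =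
    no231 L i<j j<l (punchIn-cancel-< first l<i) (punchIn-cancel-< first i<j′)
  avoid231 {zero} {suc j} {suc l} _ (s<s j<l) l<0 0<j =
    no231 L (≢0⇒0< (<⇒≢0 above ∘ ≡.sym)) j<l (later-below b (ℕ.≤-<-trans z≤n j<l) l<0) above
    where above = later-above b {j} {l} l<0 0<j

  avoid312 : ∀ {i j l} → i Fin.< j → j Fin.< l → entry (b ∷ w) j Fin.< entry (b ∷ w) l →
             ¬ (entry (b ∷ w) l Fin.< entry (b ∷ w) i)
  avoid312 {suc i} {suc j} {suc l} (s<s i<j) (s<s j<l) j<l′ l<i =
    no312 L i<j j<l (punchIn-cancel-< first j<l′) (punchIn-cancel-< first l<i)
  avoid312 {zero} {suc j} {suc l} _ (s<s j<l) j<l′ l<0 =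
    no312 L (≢0⇒0< (<⇒≢0 (Fin.<-trans j<l″ below))) j<l j<l″ below
    where
    below = later-below b (ℕ.≤-<-trans z≤n j<l) l<0
    j<l″ = punchIn-cancel-< first j<l′

entry-ascents : (w : Subset n) → ∀ i → does (entry w (inject₁ i) Fin.<? entry w (suc i)) ≡ lookup w i
entry-ascents (inside  ∷ w) zero = ≡.refl
entry-ascents (outside ∷ w) zero =
  dec-false (suc (entry w zero) Fin.<? punchIn (suc (entry w zero)) (entry w zero))
    (ℕ.<-asym (punchIn-below (suc (entry w zero)) (entry w zero) ℕ.≤-refl))
entry-ascents (b ∷ w) (suc i) =
  ≡.trans (does-⇔ (mk⇔ (punchIn-cancel-< first) (punchIn-mono-< first)) (_ Fin.<? _) (_ Fin.<? _))
          (entry-ascents w i)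
  where first = predecessor b (entry w zero)

-- Layered words in one-line notation and pattern avoidance

layered : Subset n → Vec (Fin (suc n)) (suc n)
layered w = tabulate (entry w)

lookup-layered : (w : Subset n) → lookup (layered w) ≗ entry w
lookup-layered w = Vec.lookup∘tabulate (entry w)

layered-layered : (w : Subset n) → Layered (lookup (layered w))
layered-layered w = Layered-resp-≗ (≡.sym ∘ lookup-layered w) (entry-layered w)

ascents-layered : (w : Subset n) → ascents (layered w) ≡ w
ascents-layered w = ≡.trans
  (Vec.tabulate-cong λ i →
    ≡.trans (≡.cong₂ (λ u v → does (u Fin.<? v)) (lookup-layered w (inject₁ i)) (lookup-layered w (suc i)))
            (entry-ascents w i))
  (Vec.tabulate∘lookup w)

descents≡∁ascents : (π : Vec (Fin (suc n)) (suc n)) → Layered (lookup π) → descents π ≡ ∁ (ascents π)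
descents≡∁ascents π L = ≡.trans (Vec.tabulate-cong opposite) (Vec.tabulate-∘ not _)
  where
  opposite : ∀ i → does (lookup π (suc i) Fin.<? lookup π (inject₁ i)) ≡
                   not (does (lookup π (inject₁ i) Fin.<? lookup π (suc i)))
  opposite i = does-complement (_ Fin.<? _) (_ Fin.<? _) ℕ.<-asym
    (≮⇒> L (Fin.<⇒≢ (ℕ.≤-reflexive (≡.cong suc (Fin.toℕ-inject₁ i)))))

descents-layered : (w : Subset n) → descents (layered w) ≡ ∁ w
descents-layered w =
  ≡.trans (descents≡∁ascents (layered w) (layered-layered w)) (≡.cong ∁ (ascents-layered w))

-- Trichotomy on the `g` side yields the converse implication. With a pattern as `g`, an occurrence
-- only requires its strict inequalities to be checked.
injective-sameOrder⇒⇔ : {f : Fin k → Fin m} {g : Fin k → Fin n} → (∀ {i j} → g i ≡ g j → i ≡ j) →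
  (∀ i j → g i Fin.< g j → f i Fin.< f j) → ∀ i j → f i Fin.< f j ⇔ g i Fin.< g j
injective-sameOrder⇒⇔ {f = f} {g} inj mono i j = mk⇔ to (mono i j)
  where
  to : f i Fin.< f j → g i Fin.< g j
  to fi<fj with Fin.<-cmp (g i) (g j)
  ... | tri< gi<gj _ _ = gi<gj
  ... | tri≈ _ gi≡gj _ = contradiction fi<fj (ℕ.<-irrefl (≡.cong (toℕ ∘ f) (inj gi≡gj)))
  ... | tri> _ _ gj<gi = contradiction fi<fj (ℕ.<-asym (mono j i gj<gi))

module _ (π : Vec (Fin n) n) where

  occurrence231 : ∀ {i j l} → i Fin.< j → j Fin.< l →
    lookup π l Fin.< lookup π i → lookup π i Fin.< lookup π j →
    Occurrence pattern231 π (i ∷ j ∷ l ∷ [])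
  occurrence231 {i} {j} {l} i<j j<l l<i i<j′ =
    (i<j ∷ Fin.<-trans i<j j<l ∷ []) ∷ (j<l ∷ []) ∷ [] ∷ [] ,
    injective-sameOrder⇒⇔ {f = lookup π ∘ lookup (i ∷ j ∷ l ∷ [])} {lookup pattern231}
      (Unique.lookup-injective (((λ ()) ∷ (λ ()) ∷ []) ∷ ((λ ()) ∷ []) ∷ [] ∷ []) _ _)
      λ { 0F 1F _ → i<j′ ; 2F 0F _ → l<i ; 2F 1F _ → Fin.<-trans l<i i<j′
        ; 0F 0F (s<s ()) ; 0F 2F () ; 1F 0F (s<s ()) ; 1F 1F (s<s (s<s ())) ; 1F 2F () ; 2F 2F () }

  occurrence312 : ∀ {i j l} → i Fin.< j → j Fin.< l →
    lookup π j Fin.< lookup π l → lookup π l Fin.< lookup π i →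
    Occurrence pattern312 π (i ∷ j ∷ l ∷ [])
  occurrence312 {i} {j} {l} i<j j<l j<l′ l<i =
    (i<j ∷ Fin.<-trans i<j j<l ∷ []) ∷ (j<l ∷ []) ∷ [] ∷ [] ,
    injective-sameOrder⇒⇔ {f = lookup π ∘ lookup (i ∷ j ∷ l ∷ [])} {lookup pattern312}
      (Unique.lookup-injective (((λ ()) ∷ (λ ()) ∷ []) ∷ ((λ ()) ∷ []) ∷ [] ∷ []) _ _)
      λ { 1F 2F _ → j<l′ ; 2F 0F _ → l<i ; 1F 0F _ → Fin.<-trans j<l′ l<i
        ; 0F 0F (s<s (s<s ())) ; 0F 1F () ; 0F 2F (s<s ()) ; 1F 1F () ; 2F 1F () ; 2F 2F (s<s ()) }

  avoider⇒layered : Unique π → Avoids pattern231 π → Avoids pattern312 π → Layered (lookup π)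
  avoider⇒layered unique avoids231 avoids312 = record
    { injective = Unique.lookup-injective unique _ _
    ; no231     = λ i<j j<l l<i i<j′ → avoids231 (_ , occurrence231 i<j j<l l<i i<j′)
    ; no312     = λ i<j j<l j<l′ l<i → avoids312 (_ , occurrence312 i<j j<l j<l′ l<i)
    }

  module _ (L : Layered (lookup π)) where

    layered⇒unique : Unique π
    layered⇒unique = ≡.subst Unique (Vec.tabulate∘lookup π) (Unique.tabulate⁺ (injective L))

    layered⇒avoids231 : Avoids pattern231 π
    layered⇒avoids231 (i ∷ j ∷ l ∷ [] , ((i<j ∷ _) ∷ (j<l ∷ []) ∷ _) , iso) =
      no231 L i<j j<l (Equivalence.from (iso 2F 0F) z<s) (Equivalence.from (iso 0F 1F) (s<s z<s))

    layered⇒avoids312 : Avoids pattern312 π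
    layered⇒avoids312 (i ∷ j ∷ l ∷ [] , ((i<j ∷ _) ∷ (j<l ∷ []) ∷ _) , iso) =
      no312 L i<j j<l (Equivalence.from (iso 1F 2F) z<s) (Equivalence.from (iso 2F 0F) (s<s z<s))

layered-ascents : (π : Vec (Fin (suc n)) (suc n)) → Layered (lookup π) → layered (ascents π) ≡ π
layered-ascents π L = ≡.trans
  (Vec.tabulate-cong (sameAscents⇒≗ (entry-layered w) L λ i →
    mk⇔ (does-≡⇒→ (_ Fin.<? _) (_ Fin.<? _) (same i))
        (does-≡⇒→ (_ Fin.<? _) (_ Fin.<? _) (≡.sym (same i)))))
  (Vec.tabulate∘lookup π)
  where
  w = ascents π
  same : ∀ i → does (entry w (inject₁ i) Fin.<? entry w (suc i)) ≡
               does (lookup π (inject₁ i) Fin.<? lookup π (suc i))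
  same i = ≡.trans (entry-ascents w i) (Vec.lookup∘tabulate _ i)

-- Enumeration of the avoiders by subsets

words-unique : {as : List A} → Uniqueₗ as → ∀ k → Uniqueₗ (words as k)
words-unique as! zero    = All.[] ListAllPairs.∷ ListAllPairs.[]
words-unique as! (suc k) =
  Uniqueₗ.cartesianProductWith⁺ _∷_ (λ eq → Vec.∷-injectiveˡ eq , Vec.∷-injectiveʳ eq) as! (words-unique as! k)

subsets-unique : ∀ k → Uniqueₗ (subsets k)
subsets-unique = words-unique (((λ ()) All.∷ All.[]) ListAllPairs.∷ All.[] ListAllPairs.∷ ListAllPairs.[])

-- Both lists are free of duplicates and have the same members; their orders differ in general,
-- which is harmless for a commutative sum.
avoiders↭layered : ∀ n → avoiders pattern231 pattern312 (suc n) ↭ List.map layered (subsets n)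
avoiders↭layered n = ∼bag⇒↭ (Membership.unique∧set⇒bag
  (Uniqueₗ.filter⁺ avoider? (Uniqueₗ.filter⁺ unique? (words-unique (Uniqueₗ.allFin⁺ (suc n)) (suc n))))
  (Uniqueₗ.map⁺ layered-injective (subsets-unique n))
  (mk⇔ to from))
  where
  avoider? = λ π → avoids? pattern231 π ×-dec avoids? pattern312 π
  layered-injective : ∀ {v w} → layered v ≡ layered w → v ≡ w
  layered-injective {v} {w} eq =
    ≡.trans (≡.sym (ascents-layered v)) (≡.trans (≡.cong ascents eq) (ascents-layered w))
  to : ∀ {π} → π ∈ₗ avoiders pattern231 pattern312 (suc n) → π ∈ₗ List.map layered (subsets n)
  to {π} π∈ = ≡.subst (_∈ₗ List.map layered (subsets n))
    (layered-ascents π (avoider⇒layered π unique (proj₁ avoids) (proj₂ avoids)))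
    (∈-map⁺ layered (∈-subsets (ascents π)))
    where
    avoids = proj₂ (∈-filter⁻ avoider? {xs = permutations (suc n)} π∈)
    unique = proj₂ (∈-filter⁻ unique? {xs = words (allFin (suc n)) (suc n)}
                     (proj₁ (∈-filter⁻ avoider? {xs = permutations (suc n)} π∈)))
  layered∈avoiders : ∀ w → layered w ∈ₗ avoiders pattern231 pattern312 (suc n)
  layered∈avoiders w = ∈-filter⁺ avoider?
    (∈-filter⁺ unique? (∈-words ∈-allFin (layered w)) (layered⇒unique (layered w) L))
    (layered⇒avoids231 (layered w) L , layered⇒avoids312 (layered w) L)
    where L = layered-layered w
  from : ∀ {π} → π ∈ₗ List.map layered (subsets n) → π ∈ₗ avoiders pattern231 pattern312 (suc n)
  from π∈ = ≡.subst (_∈ₗ avoiders pattern231 pattern312 (suc n)) (≡.sym π≡) (layered∈avoiders w)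
    where
    w = proj₁ (∈-map⁻ layered π∈)
    π≡ = proj₂ (proj₂ (∈-map⁻ layered π∈))

-- Rings of power series

IsCommutativeRawRing : ∀ {c ℓ} → RawRing c ℓ → Set (c ⊔ ℓ)
IsCommutativeRawRing R = IsCommutativeRing _≈_ _+_ _*_ -_ 0# 1#
  where open RawRing R

commutativeRing : ∀ {c ℓ} (R : RawRing c ℓ) → IsCommutativeRawRing R → CommutativeRing c ℓ
commutativeRing R R-isCommutativeRing = record { isCommutativeRing = R-isCommutativeRing }

module PowerSeriesProperties {c ℓ} (R : RawRing c ℓ) (R-isCommutativeRing : IsCommutativeRawRing R) where
  open RawRing R using (Carrier; _≈_; _+_; _*_; 0#; 1#)
  open CommutativeRing (commutativeRing R R-isCommutativeRing)
    hiding (Carrier; _≈_; _+_; _*_; 0#; 1#)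
  open PowerSeries R public using (constant; X) renaming (rawRing to rawRing⟦X⟧)
  open Sum semiring using (sum-cong-≋)
  open CommutativeSemigroupProperties +-commutativeSemigroup
    using (x∙yz≈y∙xz) renaming (interchange to +-interchange)
  open ≈-Reasoning setoid

  private
    module S = RawRing rawRing⟦X⟧

    -- The Cauchy product satisfies `(f * g) (suc n) = f 0 * g (suc n) + (tail f * g) n` by
    -- definition, which drives the inductions on the index below.
    tail : S.Carrier → S.Carrier
    tail f n = f (suc n)

  constant-0# : ∀ n → constant 0# n ≈ 0#
  constant-0# zero    = refl
  constant-0# (suc n) = refl

  *-cong⟦X⟧ : ∀ {f g h k} → f S.≈ g → h S.≈ k → f S.* h S.≈ g S.* k
  *-cong⟦X⟧ f≈g h≈k n = sum-cong-≋ {suc n} λ i → *-cong (f≈g (toℕ i)) (h≈k (n ℕ.∸ toℕ i))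

  zero-series-* : ∀ f n → ((λ _ → 0#) S.* f) n ≈ 0#
  zero-series-* f zero    = trans (+-identityʳ _) (zeroˡ _)
  zero-series-* f (suc n) = trans (+-cong (zeroˡ _) (zero-series-* f n)) (+-identityʳ _)

  constant-* : ∀ r f n → (constant r S.* f) n ≈ r * f n
  constant-* r f zero    = +-identityʳ _
  constant-* r f (suc n) = trans (+-congˡ (zero-series-* f n)) (+-identityʳ _)

  scale-* : ∀ r f g n → ((λ m → r * f m) S.* g) n ≈ r * (f S.* g) n
  scale-* r f g zero    = begin
    r * f 0 * g 0 + 0#    ≈⟨ +-identityʳ _ ⟩
    r * f 0 * g 0         ≈⟨ *-assoc _ _ _ ⟩
    r * (f 0 * g 0)       ≈⟨ *-congˡ (+-identityʳ _) ⟨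
    r * (f 0 * g 0 + 0#)  ∎
  scale-* r f g (suc n) = begin
    r * f 0 * g (suc n) + ((λ m → r * tail f m) S.* g) n  ≈⟨ +-cong (*-assoc _ _ _) (scale-* r (tail f) g n) ⟩
    r * (f 0 * g (suc n)) + r * (tail f S.* g) n          ≈⟨ distribˡ _ _ _ ⟨
    r * (f 0 * g (suc n) + (tail f S.* g) n)              ∎

  *-distribʳ-+ : ∀ h f g → (f S.+ g) S.* h S.≈ f S.* h S.+ g S.* h
  *-distribʳ-+ h f g zero    = begin
    (f 0 + g 0) * h 0 + 0#               ≈⟨ +-identityʳ _ ⟩
    (f 0 + g 0) * h 0                    ≈⟨ distribʳ _ _ _ ⟩
    f 0 * h 0 + g 0 * h 0                ≈⟨ +-cong (+-identityʳ _) (+-identityʳ _) ⟨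
    (f 0 * h 0 + 0#) + (g 0 * h 0 + 0#)  ∎
  *-distribʳ-+ h f g (suc n) =
    trans (+-cong (distribʳ _ _ _) (*-distribʳ-+ h (tail f) (tail g) n)) (+-interchange _ _ _ _)

  *-assoc⟦X⟧ : ∀ f g h → (f S.* g) S.* h S.≈ f S.* (g S.* h)
  *-assoc⟦X⟧ f g h zero    = +-congʳ (begin
    (f 0 * g 0 + 0#) * h 0  ≈⟨ *-congʳ (+-identityʳ _) ⟩
    f 0 * g 0 * h 0         ≈⟨ *-assoc _ _ _ ⟩
    f 0 * (g 0 * h 0)       ≈⟨ *-congˡ (+-identityʳ _) ⟨
    f 0 * (g 0 * h 0 + 0#)  ∎)
  *-assoc⟦X⟧ f g h (suc n) = begin
    (f 0 * g 0 + 0#) * h (suc n) + (((λ m → f 0 * tail g m) S.+ tail f S.* g) S.* h) n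
      ≈⟨ +-cong (*-congʳ (+-identityʳ _)) (*-distribʳ-+ h (λ m → f 0 * tail g m) (tail f S.* g) n) ⟩
    f 0 * g 0 * h (suc n) + (((λ m → f 0 * tail g m) S.* h) n + ((tail f S.* g) S.* h) n)
      ≈⟨ +-cong (*-assoc _ _ _) (+-cong (scale-* (f 0) (tail g) h n) (*-assoc⟦X⟧ (tail f) g h n)) ⟩
    f 0 * (g 0 * h (suc n)) + (f 0 * (tail g S.* h) n + (tail f S.* (g S.* h)) n)
      ≈⟨ +-assoc _ _ _ ⟨
    f 0 * (g 0 * h (suc n)) + f 0 * (tail g S.* h) n + (tail f S.* (g S.* h)) n
      ≈⟨ +-congʳ (distribˡ _ _ _) ⟨
    f 0 * (g 0 * h (suc n) + (tail g S.* h) n) + (tail f S.* (g S.* h)) n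
      ∎

  -- Unfolding splits off a coefficient of the left factor only. To split both `f 0` and `g 0`, the
  -- induction descends by two and swaps factors three times.
  *-comm⟦X⟧ : ∀ f g → f S.* g S.≈ g S.* f
  *-comm⟦X⟧ f g zero          = +-congʳ (*-comm _ _)
  *-comm⟦X⟧ f g (suc zero)    = begin
    f 0 * g 1 + (f 1 * g 0 + 0#)  ≈⟨ x∙yz≈y∙xz _ _ _ ⟩
    f 1 * g 0 + (f 0 * g 1 + 0#)  ≈⟨ +-cong (*-comm _ _) (+-congʳ (*-comm _ _)) ⟩
    g 0 * f 1 + (g 1 * f 0 + 0#)  ∎
  *-comm⟦X⟧ f g (suc (suc n)) = begin
    f 0 * g (2 ℕ.+ n) + (tail f S.* g) (suc n)
      ≈⟨ +-cong (*-comm _ _) (*-comm⟦X⟧ (tail f) g (suc n)) ⟩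
    g (2 ℕ.+ n) * f 0 + (g 0 * f (2 ℕ.+ n) + (tail g S.* tail f) n)
      ≈⟨ x∙yz≈y∙xz _ _ _ ⟩
    g 0 * f (2 ℕ.+ n) + (g (2 ℕ.+ n) * f 0 + (tail g S.* tail f) n)
      ≈⟨ +-congˡ (+-cong (*-comm _ _) (*-comm⟦X⟧ (tail g) (tail f) n)) ⟩
    g 0 * f (2 ℕ.+ n) + (f S.* tail g) (suc n)
      ≈⟨ +-congˡ (*-comm⟦X⟧ (tail g) f (suc n)) ⟨
    g 0 * f (2 ℕ.+ n) + (tail g S.* f) (suc n)
      ∎

  *-identityˡ⟦X⟧ : ∀ f → S.1# S.* f S.≈ f
  *-identityˡ⟦X⟧ f n = trans (constant-* 1# f n) (*-identityˡ (f n))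

  isCommutativeRing⟦X⟧ : IsCommutativeRawRing rawRing⟦X⟧
  isCommutativeRing⟦X⟧ = record
    { isRing = record
      { +-isAbelianGroup = record
        { isGroup = record
          { isMonoid = record
            { isSemigroup = record
              { isMagma = record
                { isEquivalence = record
                  { refl  = λ _ → refl
                  ; sym   = λ f≈g n → sym (f≈g n)
                  ; trans = λ f≈g g≈h n → trans (f≈g n) (g≈h n)
                  }
                ; ∙-cong = λ f≈g h≈k n → +-cong (f≈g n) (h≈k n)
                }
              ; assoc = λ f g h n → +-assoc (f n) (g n) (h n)
              }
            ; identity =
                (λ f n → trans (+-congʳ (constant-0# n)) (+-identityˡ (f n))) ,
                (λ f n → trans (+-congˡ (constant-0# n)) (+-identityʳ (f n)))
            }
          ; inverse =
              (λ f n → trans (-‿inverseˡ (f n)) (sym (constant-0# n))) ,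
              (λ f n → trans (-‿inverseʳ (f n)) (sym (constant-0# n)))
          ; ⁻¹-cong = λ f≈g n → -‿cong (f≈g n)
          }
        ; comm = λ f g n → +-comm (f n) (g n)
        }
      ; *-cong = *-cong⟦X⟧
      ; *-assoc = *-assoc⟦X⟧
      ; *-identity =
          *-identityˡ⟦X⟧ ,
          (λ f n → trans (*-comm⟦X⟧ f S.1# n) (*-identityˡ⟦X⟧ f n))
      ; distrib =
          (λ f g h n → trans (*-comm⟦X⟧ f (g S.+ h) n)
                        (trans (*-distribʳ-+ f g h n)
                          (+-cong (*-comm⟦X⟧ g f n) (*-comm⟦X⟧ h f n)))) ,
          *-distribʳ-+
      }
    ; *-comm = *-comm⟦X⟧
    }

  X-*-zero : ∀ f → (X S.* f) 0 ≈ 0#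
  X-*-zero f = trans (+-identityʳ _) (zeroˡ _)

  X-*-suc : ∀ f n → (X S.* f) (suc n) ≈ f n
  X-*-suc f n = begin
    0# * f (suc n) + (tail X S.* f) n  ≈⟨ +-cong (zeroˡ _) (*-cong⟦X⟧ {h = f} tail-X (λ _ → refl) n) ⟩
    0# + (S.1# S.* f) n                ≈⟨ +-identityˡ _ ⟩
    (S.1# S.* f) n                     ≈⟨ *-identityˡ⟦X⟧ f n ⟩
    f n                                ∎
    where
    tail-X : tail X S.≈ S.1#
    tail-X zero    = refl
    tail-X (suc _) = refl

ℤ⟦_⟧-isCommutativeRing : ∀ k → IsCommutativeRawRing ℤ⟦ k ⟧
ℤ⟦ zero  ⟧-isCommutativeRing = ℤ.+-*-isCommutativeRing
ℤ⟦ suc k ⟧-isCommutativeRing = PowerSeriesProperties.isCommutativeRing⟦X⟧ ℤ⟦ k ⟧ ℤ⟦ k ⟧-isCommutativeRing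

-- Elimination

module LinearSystem
  {c ℓ} {A : Set c} {equal : Rel A ℓ} {plus times : Op₂ A} {negate : Op₁ A} {zero′ one : A}
  (isCommutativeRing : IsCommutativeRing equal plus times negate zero′ one) (x p q y z : A)
  where
  private
    ring : CommutativeRing c ℓ
    ring = record { isCommutativeRing = isCommutativeRing }

  open CommutativeRing ring hiding (isCommutativeRing; ring)
  open RawSemiringDefs (Semiring.rawSemiring semiring) using (_^_)
  open GroupProperties +-group using () renaming (∙-cancelˡ to +-cancelˡ; ∙-cancelʳ to +-cancelʳ)
  open SemiringSolver commutativeSemiring
  open ≈-Reasoning setoid

  -- `denominator` is the determinant of the system for `v`, `a`, `b` below, and `remainder` is
  -- `1# - denominator` written without negation.
  numerator denominator remainder : Carrier
  numerator =
    1# + x + p * x ^ 2 * y - p ^ 2 * x ^ 2 * y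
       + q * x ^ 2 * z - q ^ 2 * x ^ 2 * z
       - p * q * x ^ 2 * y * z + p * q * x ^ 3 * y * z
       - p ^ 2 * q * x ^ 3 * y * z - p * q ^ 2 * x ^ 3 * y * z
  denominator =
    1# - p ^ 2 * x ^ 2 * y - q ^ 2 * x ^ 2 * z
       - p * q * x ^ 2 * y * z
       - p ^ 2 * q * x ^ 3 * y * z - p * q ^ 2 * x ^ 3 * y * z
  remainder =
    p ^ 2 * x ^ 2 * y + q ^ 2 * x ^ 2 * z
      + p * q * x ^ 2 * y * z
      + p ^ 2 * q * x ^ 3 * y * z + p * q ^ 2 * x ^ 3 * y * z

  -- Cramer's numerator for `v`: as all three equations have constant term 1, it is the sum of the
  -- cofactors of the column of `v`. With P = `x * p * y` and Q = `x * q * z` these are 1 - PQ, P(1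
  -- + Q) and Q(1 + P).
  product : Carrier
  product = (1# + x * p * y) * (1# + x * q * z)

  [a-b]+[c+b]≈a+c : ∀ a b c → (a - b) + (c + b) ≈ a + c
  [a-b]+[c+b]≈a+c a b c = begin
    (a - b) + (c + b)    ≈⟨ solve 4 (λ a b c b′ → (a :+ b′) :+ (c :+ b) := (a :+ c) :+ (b :+ b′)) refl a b c (- b) ⟩
    (a + c) + (b - b)    ≈⟨ +-congˡ (-‿inverseʳ b) ⟩
    (a + c) + 0#         ≈⟨ +-identityʳ _ ⟩
    a + c                ∎

  denominator+remainder≈1 : denominator + remainder ≈ 1#
  denominator+remainder≈1 =
    trans ([a-b]+[c+b]≈a+c _ _ _) (trans ([a-b]+[c+b]≈a+c _ _ _)
      (trans ([a-b]+[c+b]≈a+c _ _ _) (trans ([a-b]+[c+b]≈a+c _ _ _)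
        (trans (+-assoc _ _ _) (trans (+-congˡ (-‿inverseˡ _)) (+-identityʳ _))))))

  denominator-*-solution : ∀ {v k} → v ≈ remainder * v + k → denominator * v ≈ k
  denominator-*-solution {v} {k} v≈ = +-cancelʳ (remainder * v) _ _ (begin
    denominator * v + remainder * v  ≈⟨ distribʳ _ _ _ ⟨
    (denominator + remainder) * v    ≈⟨ *-congʳ denominator+remainder≈1 ⟩
    1# * v                           ≈⟨ *-identityˡ v ⟩
    v                                ≈⟨ v≈ ⟩
    remainder * v + k                ≈⟨ +-comm _ _ ⟩
    k + remainder * v                ∎)

  numerator≈denominator+x*product : numerator ≈ denominator + x * product
  numerator≈denominator+x*product = trans
    -- Primed variables stand for the negated monomials; the others sum to `x * product`.
    (solve 9 (λ r s t u s′ t′ u′ v′ w′ →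
      con 1 :+ r :+ s :+ s′ :+ t :+ t′ :+ u′ :+ u :+ v′ :+ w′ :=
      (con 1 :+ s′ :+ t′ :+ u′ :+ v′ :+ w′) :+ (r :+ s :+ t :+ u)) refl
      _ _ _ _ _ _ _ _ _)
    (+-congˡ (solve 5 (λ x p q y z →
      x :+ p :* x :^ 2 :* y :+ q :* x :^ 2 :* z :+ p :* q :* x :^ 3 :* y :* z :=
      x :* ((con 1 :+ x :* p :* y) :* (con 1 :+ x :* q :* z))) refl x p q y z))

  module _ {v a b : Carrier}
    (v≈ : v ≈ 1# + x * (p * y * a + q * z * b))
    (a≈ : a ≈ 1# + x * (p * v + q * z * b))
    (b≈ : b ≈ 1# + x * (p * y * a + q * v))
    where

    -- Cramer's rule for v: the three equations are combined with the
    -- cofactors 1 - c₁, c₂ and c₃, and all terms are moved so that no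
    -- subtraction occurs (the first step is then a semiring identity).
    eliminated : v ≈ remainder * v + product
    eliminated = +-cancelˡ _ _ _ (begin
      (r₁ + c₂ * r₂ + c₃ * r₃ + c₁ * v) + v
        ≈⟨ solve 8 (λ x p q y z v a b →
             let r₁ = con 1 :+ x :* (p :* y :* a :+ q :* z :* b)
                 r₂ = con 1 :+ x :* (p :* v :+ q :* z :* b)
                 r₃ = con 1 :+ x :* (p :* y :* a :+ q :* v)
                 c₁ = p :* q :* x :^ 2 :* y :* z
                 c₂ = x :* p :* y :* (con 1 :+ x :* q :* z)
                 c₃ = x :* q :* z :* (con 1 :+ x :* p :* y)
             in (r₁ :+ c₂ :* r₂ :+ c₃ :* r₃ :+ c₁ :* v) :+ v :=
                (v :+ c₂ :* a :+ c₃ :* b :+ c₁ :* r₁) :+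
                ((p :^ 2 :* x :^ 2 :* y :+ q :^ 2 :* x :^ 2 :* z
                    :+ p :* q :* x :^ 2 :* y :* z
                    :+ p :^ 2 :* q :* x :^ 3 :* y :* z :+ p :* q :^ 2 :* x :^ 3 :* y :* z) :* v
                  :+ (con 1 :+ x :* p :* y) :* (con 1 :+ x :* q :* z)))
             refl x p q y z v a b ⟩
      (v + c₂ * a + c₃ * b + c₁ * r₁) + (remainder * v + product)
        ≈⟨ +-congʳ (+-cong (+-cong (+-cong v≈ (*-congˡ a≈)) (*-congˡ b≈)) (*-congˡ (sym v≈))) ⟩
      (r₁ + c₂ * r₂ + c₃ * r₃ + c₁ * v) + (remainder * v + product)
        ∎)
      where
      r₁ = 1# + x * (p * y * a + q * z * b)
      r₂ = 1# + x * (p * v + q * z * b)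
      r₃ = 1# + x * (p * y * a + q * v)
      c₁ = p * q * x ^ 2 * y * z
      c₂ = x * p * y * (1# + x * q * z)
      c₃ = x * q * z * (1# + x * p * y)

    denominator-*-[1+x*v] : denominator * (1# + x * v) ≈ numerator
    denominator-*-[1+x*v] = begin
      denominator * (1# + x * v)
        ≈⟨ solve 3 (λ d x v → d :* (con 1 :+ x :* v) := d :+ x :* (d :* v)) refl denominator x v ⟩
      denominator + x * (denominator * v)
        ≈⟨ +-congˡ (*-congˡ (denominator-*-solution eliminated)) ⟩
      denominator + x * product
        ≈⟨ numerator≈denominator+x*product ⟨
      numerator
        ∎

  -- Expanding gives `g ≈ remainder * g + 1#`, the case `k = 1#` of `denominator-*-solution`. The
  -- nested form matches the coefficient recurrence of `recurrent`.
  denominator-*-recurrence : ∀ {g} →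
    g ≈ 1# + x * (x * ((p * p * y + q * q * z + p * q * y * z) * g
                       + x * ((p * p * q * y * z + p * q * q * y * z) * g))) →
    denominator * g ≈ 1#
  denominator-*-recurrence {g} g≈ = denominator-*-solution (trans g≈ (solve 6 (λ x p q y z g →
    con 1 :+ x :* (x :* ((p :* p :* y :+ q :* q :* z :+ p :* q :* y :* z) :* g
                         :+ x :* ((p :* p :* q :* y :* z :+ p :* q :* q :* y :* z) :* g))) :=
    (p :^ 2 :* x :^ 2 :* y :+ q :^ 2 :* x :^ 2 :* z
      :+ p :* q :* x :^ 2 :* y :* z
      :+ p :^ 2 :* q :* x :^ 3 :* y :* z :+ p :* q :^ 2 :* x :^ 3 :* y :* z) :* g :+ con 1)
    refl x p q y z g))

  -- All operations are bound as variables, so that for a concrete ring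
  -- the statement consists of literally the operations given: comparing
  -- it with other forms of them would unfold the Cauchy products.
  solution : {minus : Op₂ A} {power : A → ℕ → A} → minus ≡ _-_ → power ≡ _^_ →
    let infix 4 _≈_
        _≈_ = equal
        infixl 6 _+_ _-_
        _+_ = plus
        _-_ = minus
        infixl 7 _*_
        _*_ = times
        infixr 8 _^_
        _^_ = power
        1# = one
        N = 1# + x + p * x ^ 2 * y - p ^ 2 * x ^ 2 * y
              + q * x ^ 2 * z - q ^ 2 * x ^ 2 * z
              - p * q * x ^ 2 * y * z + p * q * x ^ 3 * y * z
              - p ^ 2 * q * x ^ 3 * y * z - p * q ^ 2 * x ^ 3 * y * z
        D = 1# - p ^ 2 * x ^ 2 * y - q ^ 2 * x ^ 2 * z
              - p * q * x ^ 2 * y * z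
              - p ^ 2 * q * x ^ 3 * y * z - p * q ^ 2 * x ^ 3 * y * z
    in ∀ {v a b f g} →
       v ≈ 1# + x * (p * y * a + q * z * b) →
       a ≈ 1# + x * (p * v + q * z * b) →
       b ≈ 1# + x * (p * y * a + q * v) →
       f ≈ 1# + x * v →
       g ≈ 1# + x * (x * ((p * p * y + q * q * z + p * q * y * z) * g
                          + x * ((p * p * q * y * z + p * q * q * y * z) * g))) →
       (D * g ≈ 1#) × (f ≈ N * g)
  solution ≡.refl ≡.refl {v} {f = f} {g} v≈ a≈ b≈ f≈ g≈ = D*g≈1 , (begin
    f                                 ≈⟨ *-identityˡ f ⟨
    1# * f                            ≈⟨ *-congʳ D*g≈1 ⟨
    denominator * g * f               ≈⟨ solve 3 (λ d g f → d :* g :* f := d :* f :* g) refl denominator g f ⟩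
    denominator * f * g               ≈⟨ *-congʳ (*-congˡ f≈) ⟩
    denominator * (1# + x * v) * g    ≈⟨ *-congʳ (denominator-*-[1+x*v] v≈ a≈ b≈) ⟩
    numerator * g                     ∎)
    where D*g≈1 = denominator-*-recurrence g≈

-- Sums over ascent sets

module SubsetSums {c ℓ} (R : RawRing c ℓ) (R-isCommutativeRing : IsCommutativeRawRing R) where
  open RawRing R using (Carrier; _≈_; _+_; _*_; 0#; 1#)
  open CommutativeRing (commutativeRing R R-isCommutativeRing)
    hiding (Carrier; _≈_; _+_; _*_; 0#; 1#)

  total : List Carrier → Carrier
  total = foldr _+_ 0#

  subsetSum : (∀ {n} → Subset n → Carrier) → ℕ → Carrier
  subsetSum f n = total (List.map f (subsets n))

  total-++ : ∀ xs ys → total (xs ++ ys) ≈ total xs + total ys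
  total-++ []       ys = sym (+-identityˡ _)
  total-++ (x ∷ xs) ys = trans (+-congˡ (total-++ xs ys)) (sym (+-assoc _ _ _))

  total-map-* : ∀ {a b} {A : Set a} {B : Set b} {f : B → Carrier} {g : A → Carrier} {h : A → B} {r} →
                (∀ x → f (h x) ≈ r * g x) →
                ∀ xs → total (List.map f (List.map h xs)) ≈ r * total (List.map g xs)
  total-map-* fh≈rg []       = sym (zeroʳ _)
  total-map-* fh≈rg (x ∷ xs) = trans (+-cong (fh≈rg x) (total-map-* fh≈rg xs)) (sym (distribˡ _ _ _))

  -- One row of the transfer matrix: the first position is either an ascent of weight `r`, leading
  -- to state `g`, or a descent of weight `s`, leading to state `h`.
  subsetSum-suc : ∀ {f g h : ∀ {n} → Subset n → Carrier} {r s} →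
    (∀ {n} (S : Subset n) → f (inside ∷ S) ≈ r * g S) →
    (∀ {n} (S : Subset n) → f (outside ∷ S) ≈ s * h S) →
    ∀ n → subsetSum f (suc n) ≈ r * subsetSum g n + s * subsetSum h n
  subsetSum-suc {f} {g} {h} {r} {s} f-inside f-outside n = begin
    total (List.map f (ins ++ (outs ++ [])))
      ≡⟨ ≡.cong total (≡.trans (≡.cong (λ xs → List.map f (ins ++ xs)) (List.++-identityʳ outs)) (List.map-++ f ins outs)) ⟩
    total (List.map f ins ++ List.map f outs)
      ≈⟨ total-++ (List.map f ins) (List.map f outs) ⟩
    total (List.map f ins) + total (List.map f outs)
      ≈⟨ +-cong (total-map-* f-inside (subsets n)) (total-map-* f-outside (subsets n)) ⟩
    r * subsetSum g n + s * subsetSum h n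
      ∎
    where
    open ≈-Reasoning setoid
    ins  = List.map (inside ∷_) (subsets n)
    outs = List.map (outside ∷_) (subsets n)

module Weights (m : ℕ) (p q y z : RawRing.Carrier ℤ⟦ m ⟧) where
  open RawRing ℤ⟦ m ⟧ using (Carrier; _≈_; _+_; _*_; 0#; 1#; rawSemiring)
  open CommutativeRing (commutativeRing ℤ⟦ m ⟧ ℤ⟦ m ⟧-isCommutativeRing)
    hiding (Carrier; _≈_; _+_; _*_; 0#; 1#)
  open RawSemiringDefs rawSemiring using (_^_)
  open SubsetSums ℤ⟦ m ⟧ ℤ⟦ m ⟧-isCommutativeRing

  monomial : ℕ → ℕ → ℕ → ℕ → Carrier
  monomial i j k l = p ^ i * q ^ j * y ^ k * z ^ l

  -- The weight of a permutation with ascent set S, and its variants for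
  -- which an ascent (respectively a descent) in the first position
  -- cannot be chosen, because the one just before it already is.
  free afterAscent afterDescent : ∀ {n} → Subset n → Carrier
  free         S = monomial ∣ S ∣ ∣ ∁ S ∣ (greedy S) (greedy (∁ S))
  afterAscent  S = monomial ∣ S ∣ ∣ ∁ S ∣ (skip S)   (greedy (∁ S))
  afterDescent S = monomial ∣ S ∣ ∣ ∁ S ∣ (greedy S) (skip (∁ S))

  freeSeries afterAscentSeries afterDescentSeries : ℕ → Carrier
  freeSeries         = subsetSum free
  afterAscentSeries  = subsetSum afterAscent
  afterDescentSeries = subsetSum afterDescent

  open SemiringSolver commutativeSemiring

  monomial-zero : monomial 0 0 0 0 ≈ 1#
  monomial-zero = solve 0 (con 1 :* con 1 :* con 1 :* con 1 := con 1) refl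

  monomial-py : ∀ i j k l → monomial (suc i) j (suc k) l ≈ p * y * monomial i j k l
  monomial-py i j k l = solve 6 (λ p y a b c d →
    p :* a :* b :* (y :* c) :* d := p :* y :* (a :* b :* c :* d)) refl p y (p ^ i) (q ^ j) (y ^ k) (z ^ l)

  monomial-qz : ∀ i j k l → monomial i (suc j) k (suc l) ≈ q * z * monomial i j k l
  monomial-qz i j k l = solve 6 (λ q z a b c d →
    a :* (q :* b) :* c :* (z :* d) := q :* z :* (a :* b :* c :* d)) refl q z (p ^ i) (q ^ j) (y ^ k) (z ^ l)

  monomial-p : ∀ i j k l → monomial (suc i) j k l ≈ p * monomial i j k l
  monomial-p i j k l = solve 5 (λ p a b c d →
    p :* a :* b :* c :* d := p :* (a :* b :* c :* d)) refl p (p ^ i) (q ^ j) (y ^ k) (z ^ l)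

  monomial-q : ∀ i j k l → monomial i (suc j) k l ≈ q * monomial i j k l
  monomial-q i j k l = solve 5 (λ q a b c d →
    a :* (q :* b) :* c :* d := q :* (a :* b :* c :* d)) refl q (p ^ i) (q ^ j) (y ^ k) (z ^ l)

  free-zero : freeSeries 0 ≈ 1#
  free-zero = trans (+-identityʳ _) monomial-zero

  afterAscent-zero : afterAscentSeries 0 ≈ 1#
  afterAscent-zero = trans (+-identityʳ _) monomial-zero

  afterDescent-zero : afterDescentSeries 0 ≈ 1#
  afterDescent-zero = trans (+-identityʳ _) monomial-zero

  free-suc : ∀ n → freeSeries (suc n) ≈
             p * y * afterAscentSeries n + q * z * afterDescentSeries n
  free-suc = subsetSum-suc {free} {afterAscent} {afterDescent}
    (λ S → monomial-py ∣ S ∣ ∣ ∁ S ∣ (skip S) (greedy (∁ S)))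
    (λ S → monomial-qz ∣ S ∣ ∣ ∁ S ∣ (greedy S) (skip (∁ S)))

  afterAscent-suc : ∀ n → afterAscentSeries (suc n) ≈
                    p * freeSeries n + q * z * afterDescentSeries n
  afterAscent-suc = subsetSum-suc {afterAscent} {free} {afterDescent}
    (λ S → monomial-p ∣ S ∣ ∣ ∁ S ∣ (greedy S) (greedy (∁ S)))
    (λ S → monomial-qz ∣ S ∣ ∣ ∁ S ∣ (greedy S) (skip (∁ S)))

  afterDescent-suc : ∀ n → afterDescentSeries (suc n) ≈
                     p * y * afterAscentSeries n + q * freeSeries n
  afterDescent-suc = subsetSum-suc {afterDescent} {afterAscent} {free}
    (λ S → monomial-py ∣ S ∣ ∣ ∁ S ∣ (skip S) (greedy (∁ S)))
    (λ S → monomial-q ∣ S ∣ ∣ ∁ S ∣ (greedy S) (greedy (∁ S)))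

-- From coefficient recurrences to equations between series

module K where
  open RawRing ℤ⟦ 4 ⟧ public using (Carrier; _≈_; _+_; _*_; 0#; 1#)
  open CommutativeRing (commutativeRing ℤ⟦ 4 ⟧ ℤ⟦ 4 ⟧-isCommutativeRing) public
    hiding (Carrier; _≈_; _+_; _*_; 0#; 1#)
  open PowerSeriesProperties ℤ⟦ 4 ⟧ ℤ⟦ 4 ⟧-isCommutativeRing public
    using (constant-*; X-*-zero; X-*-suc)

open import Defs

isCommutativeRing : IsCommutativeRing _≈_ _+_ _*_ -_ 0# 1#
isCommutativeRing = ℤ⟦ 5 ⟧-isCommutativeRing

-- `P` acts as the constant series `r`, expressed by its action so that sums and products compose.
-- As a record it lets `r` and `P` be inferred from the type.
record Multiplies (r : K.Carrier) (P : Carrier) : Set where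
  constructor multiplies
  field
    apply : ∀ f n → (P * f) n K.≈ r K.* f n

open Multiplies

multiplies-+ : ∀ {r s P Q} → Multiplies r P → Multiplies s Q → Multiplies (r K.+ s) (P + Q)
multiplies-+ {r} {s} {P} {Q} rP sQ = multiplies λ f n →
  K.trans (distribʳ f P Q n) (K.trans (K.+-cong (apply rP f n) (apply sQ f n)) (K.sym (K.distribʳ (f n) r s)))
  where open IsCommutativeRing isCommutativeRing using (distribʳ)

multiplies-* : ∀ {r s P Q} → Multiplies r P → Multiplies s Q → Multiplies (r K.* s) (P * Q)
multiplies-* {r} {s} {P} {Q} rP sQ = multiplies λ f n →
  K.trans (*-assoc P Q f n) (K.trans (apply rP (Q * f) n)
    (K.trans (K.*-congˡ {r} (apply sQ f n)) (K.sym (K.*-assoc r s (f n)))))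
  where open IsCommutativeRing isCommutativeRing using (*-assoc)

series-equation : ∀ {f g h r s P Q} → Multiplies r P → Multiplies s Q →
  f 0 K.≈ K.1# → (∀ n → f (suc n) K.≈ r K.* g n K.+ s K.* h n) →
  f ≈ 1# + x * (P * g + Q * h)
series-equation {f} {g} {h} {r} {s} {P} {Q} rP sQ f0≈1 f-suc zero =
  K.trans f0≈1 (K.sym (K.trans (K.+-congˡ {K.1#} (K.X-*-zero (P * g + Q * h))) (K.+-identityʳ K.1#)))
series-equation {f} {g} {h} {r} {s} {P} {Q} rP sQ f0≈1 f-suc (suc n) =
  K.trans (f-suc n) (K.sym
    (K.trans (K.+-identityˡ ((x * (P * g + Q * h)) (suc n)))
      (K.trans (K.X-*-suc (P * g + Q * h) n) (K.+-cong (apply rP g n) (apply sQ h n)))))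

1+x*x*-suc-suc : ∀ f n → (1# + x * (x * f)) (suc (suc n)) K.≈ f n
1+x*x*-suc-suc f n = K.trans (K.+-identityˡ ((x * (x * f)) (suc (suc n))))
  (K.trans (K.X-*-suc (x * f) (suc n)) (K.X-*-suc f n))

recurrence-equation : ∀ {a b A B g} → Multiplies a A → Multiplies b B →
  g 0 K.≈ K.1# → g 1 K.≈ K.0# → g 2 K.≈ a →
  (∀ n → g (suc (suc (suc n))) K.≈ a K.* g (suc n) K.+ b K.* g n) →
  g ≈ 1# + x * (x * (A * g + x * (B * g)))
recurrence-equation {a} {b} {A} {B} {g} aA bB g0 g1 g2 g3+ 0 =
  K.trans g0 (K.sym (K.trans
    (K.+-congˡ {K.1#} (K.X-*-zero (x * (A * g + x * (B * g))))) (K.+-identityʳ K.1#)))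
recurrence-equation {a} {b} {A} {B} {g} aA bB g0 g1 g2 g3+ 1 =
  K.trans g1 (K.sym (K.trans (K.+-identityˡ ((x * (x * (A * g + x * (B * g)))) 1))
    (K.trans (K.X-*-suc (x * (A * g + x * (B * g))) 0) (K.X-*-zero (A * g + x * (B * g))))))
recurrence-equation {a} {b} {A} {B} {g} aA bB g0 g1 g2 g3+ 2 =
  K.trans g2 (K.sym (K.trans (1+x*x*-suc-suc (A * g + x * (B * g)) 0) (K.trans
    (K.+-cong (K.trans (apply aA g 0) (K.trans (K.*-congˡ {a} g0) (K.*-identityʳ a))) (K.X-*-zero (B * g)))
    (K.+-identityʳ a))))
recurrence-equation {a} {b} {A} {B} {g} aA bB g0 g1 g2 g3+ (suc (suc (suc n))) =
  K.trans (g3+ n) (K.sym (K.trans (1+x*x*-suc-suc (A * g + x * (B * g)) (suc n))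
    (K.+-cong (apply aA g (suc n)) (K.trans (K.X-*-suc (B * g) n) (apply bB g n)))))

p-multiplies : Multiplies (var 4 0F) p
p-multiplies = multiplies (K.constant-* (var 4 0F))

q-multiplies : Multiplies (var 4 1F) q
q-multiplies = multiplies (K.constant-* (var 4 1F))

y-multiplies : Multiplies (var 4 2F) y
y-multiplies = multiplies (K.constant-* (var 4 2F))

z-multiplies : Multiplies (var 4 3F) z
z-multiplies = multiplies (K.constant-* (var 4 3F))

py-multiplies : Multiplies (var 4 0F K.* var 4 2F) (p * y)
py-multiplies = multiplies-* p-multiplies y-multiplies

qz-multiplies : Multiplies (var 4 1F K.* var 4 3F) (q * z)
qz-multiplies = multiplies-* q-multiplies z-multiplies

shift-equation : ∀ {f g : Carrier} → f 0 K.≈ K.1# → (∀ n → f (suc n) K.≈ g n) → f ≈ 1# + x * g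
shift-equation {f} {g} f0 f-suc zero    =
  K.trans f0 (K.sym (K.trans (K.+-congˡ {K.1#} (K.X-*-zero g)) (K.+-identityʳ K.1#)))
shift-equation {f} {g} f0 f-suc (suc n) =
  K.trans (f-suc n) (K.sym (K.trans (K.+-identityˡ ((x * g) (suc n))) (K.X-*-suc g n)))

-- The coefficients of 1 / (1 - a X² - b X³).
recurrent : K.Carrier → K.Carrier → Carrier
recurrent a b 0                   = K.1#
recurrent a b 1                   = K.0#
recurrent a b 2                   = a
recurrent a b (suc (suc (suc n))) = a K.* recurrent a b (suc n) K.+ b K.* recurrent a b n

recurrent-equation : ∀ {a b A B} → Multiplies a A → Multiplies b B →
  recurrent a b ≈ 1# + x * (x * (A * recurrent a b + x * (B * recurrent a b)))
recurrent-equation {a} {b} {A} {B} aA bB =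
  recurrence-equation {a} {b} {A} {B} {recurrent a b} aA bB K.refl K.refl K.refl (λ _ → K.refl)

-- These two equations are what `solution` asks for; they compare the bare operators rather than the
-- large expressions built from them.
minus-def : _-_ ≡ CommutativeRing._-_ (commutativeRing ℤ⟦ 5 ⟧ isCommutativeRing)
minus-def = ≡.refl

power-def : _^_ ≡ RawSemiringDefs._^_
  (Semiring.rawSemiring (CommutativeRing.semiring (commutativeRing ℤ⟦ 5 ⟧ isCommutativeRing)))
power-def = ≡.refl

-- The denominator is 1 - α x² - β x³ for the following α and β.
α-multiplies =
  multiplies-+
    (multiplies-+ (multiplies-* (multiplies-* p-multiplies p-multiplies) y-multiplies)
                  (multiplies-* (multiplies-* q-multiplies q-multiplies) z-multiplies))
    (multiplies-* (multiplies-* (multiplies-* p-multiplies q-multiplies) y-multiplies) z-multiplies)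
β-multiplies =
  multiplies-+
    (multiplies-* (multiplies-* (multiplies-*
      (multiplies-* p-multiplies p-multiplies) q-multiplies) y-multiplies) z-multiplies)
    (multiplies-* (multiplies-* (multiplies-*
      (multiplies-* p-multiplies q-multiplies) q-multiplies) y-multiplies) z-multiplies)

-- The algebraic half of the proof: the series are arbitrary and enter through their recurrences
-- alone, so no permutation is involved.
rational : ∀ {f v a b : Carrier} {α β} →
  Multiplies α (p * p * y + q * q * z + p * q * y * z) →
  Multiplies β (p * p * q * y * z + p * q * q * y * z) →
  f 0 K.≈ K.1# → (∀ n → f (suc n) K.≈ v n) →
  v 0 K.≈ K.1# → (∀ n → v (suc n) K.≈ var 4 0F K.* var 4 2F K.* a n K.+ var 4 1F K.* var 4 3F K.* b n) →
  a 0 K.≈ K.1# → (∀ n → a (suc n) K.≈ var 4 0F K.* v n K.+ var 4 1F K.* var 4 3F K.* b n) →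
  b 0 K.≈ K.1# → (∀ n → b (suc n) K.≈ var 4 0F K.* var 4 2F K.* a n K.+ var 4 1F K.* v n) →
  let N = 1# + x + p * x ^ 2 * y - p ^ 2 * x ^ 2 * y
            + q * x ^ 2 * z - q ^ 2 * x ^ 2 * z
            - p * q * x ^ 2 * y * z + p * q * x ^ 3 * y * z
            - p ^ 2 * q * x ^ 3 * y * z - p * q ^ 2 * x ^ 3 * y * z
      D = 1# - p ^ 2 * x ^ 2 * y - q ^ 2 * x ^ 2 * z
            - p * q * x ^ 2 * y * z
            - p ^ 2 * q * x ^ 3 * y * z - p * q ^ 2 * x ^ 3 * y * z
  in ∃[ D⁻¹ ] (D * D⁻¹ ≈ 1#) × (f ≈ N * D⁻¹)
rational {f} {v} {a} {b} {α} {β} mα mβ f0 f-suc v0 v-suc a0 a-suc b0 b-suc =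
  recurrent α β ,
  LinearSystem.solution isCommutativeRing x p q y z minus-def power-def
    {v} {a} {b} {f} {recurrent α β}
    (series-equation {v} {a} {b} py-multiplies qz-multiplies v0 v-suc)
    (series-equation {a} {v} {b} p-multiplies qz-multiplies a0 a-suc)
    (series-equation {b} {a} {v} py-multiplies q-multiplies b0 b-suc)
    (shift-equation {f} {v} f0 f-suc)
    (recurrent-equation {α} {β} mα mβ)

-- The coefficients of the generating function

module W = Weights 4 (var 4 0F) (var 4 1F) (var 4 2F) (var 4 3F)

weight≡monomial : (π : Vec (Fin n) n) → ∀ {i j k l} →
  asc π ≡ i → des π ≡ j → MNA π ≡ k → MND π ≡ l →
  weight π ≡ Weights.monomial 4 (var 4 0F) (var 4 1F) (var 4 2F) (var 4 3F) i j k l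
weight≡monomial π ≡.refl ≡.refl ≡.refl ≡.refl = ≡.refl

weight-layered : (S : Subset n) →
  weight (layered S) ≡ Weights.free 4 (var 4 0F) (var 4 1F) (var 4 2F) (var 4 3F) S
weight-layered S = weight≡monomial (layered S) {∣ S ∣} {∣ ∁ S ∣} {greedy S} {greedy (∁ S)}
  (≡.cong ∣_∣ (ascents-layered S))
  (≡.cong ∣_∣ (descents-layered S))
  (≡.trans (≡.cong maxNonAdjacent (ascents-layered S)) (maxNonAdjacent≡greedy S))
  (≡.trans (≡.cong maxNonAdjacent (descents-layered S)) (maxNonAdjacent≡greedy (∁ S)))

G-suc : ∀ n → G pattern231 pattern312 (suc n) K.≈ W.freeSeries n
G-suc n = K.trans
  (PermutationSetoid.foldr-commMonoid K.setoid K.+-isCommutativeMonoid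
    (↭⇒↭ₛ′ K.isEquivalence (Permutation.map⁺ weight (avoiders↭layered n))))
  (K.reflexive (≡.cong (foldr K._+_ K.0#)
    (≡.trans (≡.sym (List.map-∘ (subsets n))) (List.map-cong weight-layered (subsets n)))))

-- The empty permutation is not of the form `layered S`, whose length is positive, so the constant
-- term is computed directly.
G-zero : G pattern231 pattern312 0 K.≈ K.1#
G-zero = K.trans (K.+-identityʳ _)
  (K.trans (K.reflexive (weight≡monomial {0} Vec.[] ≡.refl ≡.refl ≡.refl ≡.refl))
    W.monomial-zero)

theorem6 :
  let N = 1# + x + p * x ^ 2 * y - p ^ 2 * x ^ 2 * y
            + q * x ^ 2 * z - q ^ 2 * x ^ 2 * z
            - p * q * x ^ 2 * y * z + p * q * x ^ 3 * y * z
            - p ^ 2 * q * x ^ 3 * y * z - p * q ^ 2 * x ^ 3 * y * z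
      D = 1# - p ^ 2 * x ^ 2 * y - q ^ 2 * x ^ 2 * z
            - p * q * x ^ 2 * y * z
            - p ^ 2 * q * x ^ 3 * y * z - p * q ^ 2 * x ^ 3 * y * z
  in ∃[ D⁻¹ ] (D * D⁻¹ ≈ 1#) × (G pattern231 pattern312 ≈ N * D⁻¹)
theorem6 = rational
  {G pattern231 pattern312} {W.freeSeries} {W.afterAscentSeries} {W.afterDescentSeries}
  α-multiplies β-multiplies
  G-zero G-suc
  W.free-zero         W.free-suc
  W.afterAscent-zero  W.afterAscent-suc
  W.afterDescent-zero W.afterDescent-suc
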